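{- Let $A$ be a set and let $\Gamma$ be a countable (finite or countably infinite) set of unary relations on $A$ (i.e. subsets of $A$) containing some $\gamma\in\Gamma$ with $\emptyset\neq\gamma\subsetneq A$. Then $$\bigl|\{\operatorname{Pol}_A Q \mid Q\subseteq \mathrm{DD}(\Gamma),\ Q \text{ finite}\}\bigr| = \aleph_0 .$$
   Context: An $n$-ary relation on $A$ is a subset of $A^n$; an $n$-ary operation on $A$ is a map $A^n\to A$. Let $\mathrm{O}_A$ be the set of all operations on $A$ of arity $n\geq 1$. An $n$-ary operation $f$ preserves an $m$-ary relation $\rho\subseteq A^m$ (written $f\rhd\rho$) if for all $r_1,\dots,r_n\in\rho$ the $m$-tuple obtained by applying $f$ coordinatewise to $r_1,\dots,r_n$ is in $\rho$. For a set $Q$ of finitary relations on $A$ (of positive arity), $\operatorname{Pol}_A Q=\{f\in \mathrm{O}_A\mid f\rhd\rho \text{ for all }\rho\in Q\}$. For $n\geq 1$ and $\gamma_1,\dots,\gamma_n\subseteq A$ put $\mathrm{R}(\gamma_1,\dots,\gamma_n)=\{(x_1,\dots,x_n)\in A^n\mid x_1\in\gamma_1\text{ or }\dots\text{ or }x_n\in\gamma_n\}$. For a set $\Gamma$ of unary relations on $A$, $\mathrm{DD}(\Gamma)$ is the set of all relations $\mathrm{R}(\gamma_1,\dots,\gamma_n)$ with $n\geq 1$ and $(\gamma_1,\dots,\gamma_n)\in\Gamma^n$. -}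

module Defs where

open import Data.Fin using (Fin)
import Data.Fin.Properties as Fin
open import Data.Nat using (ℕ; suc)
open import Data.Product using (Σ; ∃; ∃-syntax; _×_; _,_; proj₁)
open import Data.Sum using (_⊎_)
open import Data.Vec using (Vec; lookup; tabulate)
open import Function.Bundles using (Bijection)
open import Level using (Level; _⊔_) renaming (suc to lsuc)
open import Relation.Binary.Bundles using (Setoid)
import Relation.Binary.Construct.On as On
open import Relation.Binary.PropositionalEquality using (setoid)
open import Relation.Unary using (Pred; _∈_; _⊆_; _≐_)
open import Relation.Unary.Properties using (≐-refl; ≐-sym; ≐-trans)
open import Relation.Unary.Relation.Binary.Equality using (≐-setoid)

private
  variable
    a c ℓ p : Level

-- The elements of S that satisfy P, compared by the equality of S.
members : (S : Setoid c ℓ) → Pred (Setoid.Carrier S) p → Setoid (c ⊔ p) ℓ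
members S P = On.setoid {B = Σ (Setoid.Carrier S) P} S proj₁

Finite : Setoid c ℓ → Set (c ⊔ ℓ)
Finite S = ∃[ n ] Bijection (Fin.≡-setoid n) S

CountablyInfinite : Setoid c ℓ → Set (c ⊔ ℓ)
CountablyInfinite S = Bijection (setoid ℕ) S

Countable : Setoid c ℓ → Set (c ⊔ ℓ)
Countable S = Finite S ⊎ CountablyInfinite S

-- Arities are positive: in Operation and Relation, the first component k
-- stands for arity suc k.
Operation : Set a → Set a
Operation A = ∃[ k ] (Vec A (suc k) → A)

Relation : Set a → Set (lsuc a)
Relation {a} A = ∃[ k ] Pred (Vec A (suc k)) a

-- Relations are equal when they have the same arity and the same tuples.
data _≋_ {a : Level} {A : Set a} : Relation A → Relation A → Set (lsuc a) where
  same : ∀ {k} {ρ σ : Pred (Vec A (suc k)) a} → ρ ≐ σ → (k , ρ) ≋ (k , σ)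

relationSetoid : Set a → Setoid (lsuc a) (lsuc a)
relationSetoid A = record
  { Carrier       = Relation A
  ; _≈_           = _≋_
  ; isEquivalence = record
    { refl  = same ≐-refl
    ; sym   = λ { (same e) → same (≐-sym e) }
    ; trans = λ { (same e) (same e′) → same (≐-trans e e′) }
    }
  }

_▷_ : {A : Set a} → Operation A → Relation A → Set a
_▷_ {A = A} (n , f) (m , ρ) =
  (r : Fin (suc n) → Vec A (suc m)) → (∀ i → r i ∈ ρ) →
  tabulate (λ j → f (tabulate (λ i → lookup (r i) j))) ∈ ρ

Pol : {A : Set a} → Pred (Relation A) (lsuc a) → Pred (Operation A) (lsuc a)
Pol Q f = ∀ ρ → ρ ∈ Q → f ▷ ρ

R : ∀ {A : Set a} {n} → (Fin n → Pred A a) → Pred (Vec A n) a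
R γ x = ∃[ i ] lookup x i ∈ γ i

DD : {A : Set a} → Pred (Pred A a) (lsuc a) → Pred (Relation A) (lsuc a)
DD {a} {A} Γ (k , ρ) =
  Σ (Fin (suc k) → Pred A a) λ γ → (∀ i → γ i ∈ Γ) × ρ ≐ R γ

-- { Pol Q ∣ Q ⊆ DD Γ, Q finite } as a set of sets of operations, so that
-- different Q with the same polymorphisms give the same element.
finiteDDClones : {A : Set a} → Pred (Pred A a) (lsuc a) →
                 Setoid (lsuc (lsuc a)) (lsuc a)
finiteDDClones {a} {A} Γ = members (≐-setoid (Operation A) (lsuc a)) λ C →
  Σ (Pred (Relation A) (lsuc a)) λ Q →
    Q ⊆ DD Γ × Finite (members (relationSetoid A) Q) × C ≐ Pol Q

{-# OPTIONS --safe #-}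

-- Upper bound: with Γ enumerated by natural numbers, a finite subset of DD(Γ)
-- is coded by a finite list of finite lists of natural numbers, hence by a
-- natural number. Lower bound: for a ∈ γ and b ∉ γ, let f of arity m + 1 take
-- the value a if at least two arguments lie in γ, and b otherwise. Then f
-- preserves the m-ary relation R(γ,…,γ) by the pigeonhole principle, but not
-- the n-ary one for n > m: at each coordinate, at most one of m + 1 "unit
-- vectors" has its entry in γ. A set with decidable equality that is both an
-- image of ℕ and infinite is in bijection with ℕ: keep the indices at which an
-- element is listed for the first time.
module Submission where

open import Defs
open import Axiom.ExcludedMiddle using (ExcludedMiddle)
open import Data.Product using (∃-syntax; _×_)
open import Level using (Level; suc)
open import Relation.Nullary using (¬_)
open import Relation.Unary using (Pred; _∈_; _⊂_; _≐_; ∅; U)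
open import Relation.Unary.Relation.Binary.Equality using (≐-setoid)

open import Data.Fin as Fin using (Fin; toℕ; fromℕ<; inject≤)
open import Data.Fin.Properties as Fin
  using (all?; ¬∀⟶∃¬; pigeonhole; toℕ<n; fromℕ<-toℕ; inject≤-injective)
open import Data.List as List using (List; []; _∷_; deduplicate; length)
import Data.List.Membership.Setoid as Membership
import Data.List.Membership.Setoid.Properties as Membershipₚ
open import Data.List.Relation.Unary.All as All using (All; []; _∷_)
import Data.List.Relation.Unary.All.Properties as Allₚ
open import Data.List.Relation.Unary.Any using (here; index)
import Data.List.Relation.Unary.Any.Properties as Anyₚ
open import Data.List.Relation.Unary.AllPairs using (_∷_)
open import Data.List.Relation.Unary.Unique.Setoid using (Unique)
open import Data.List.Relation.Unary.Unique.DecSetoid.Properties using (deduplicate-!)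
open import Data.Nat using (ℕ; zero; _≤_; _<_; z≤n; s≤s; s<s⁻¹; _≤?_; _<?_)
open import Data.Nat.Binary using (ℕᵇ; 2[1+_]; 1+[2_]; fromℕ) renaming (zero to 0ᵇ; toℕ to toℕᵇ)
open import Data.Nat.Binary.Properties using (fromℕ-toℕ)
open import Data.Nat.Properties as ℕ
  using (anyUpTo?; allUpTo?; ≤-refl; ≤-<-trans; ≮⇒≥; m<1+n⇒m<n∨m≡n; <-cmp)
open import Data.Product as Product using (∃; _,_; proj₁; proj₂)
open import Data.Sum using (inj₁; inj₂)
open import Data.Vec using (Vec; lookup; tabulate)
open import Data.Vec.Properties using (lookup∘tabulate)
open import Function using (_∘_; const; StrictlySurjective; Injective)
open import Function.Bundles using (Bijection)
open import Function.Consequences.Setoid using (strictlySurjective⇒surjective)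
open import Level using (Lift; lift; lower)
open import Relation.Binary.Bundles using (Setoid; DecSetoid)
open import Relation.Binary.Definitions using (tri<; tri≈; tri>)
open import Relation.Binary.Properties.Setoid using (respʳ-flip)
open import Relation.Binary.PropositionalEquality
  using (_≡_; _≢_; refl; sym; trans; cong; subst; setoid)
open import Relation.Nullary using (Dec; yes; no; contradiction; _×-dec_; ¬?)
open import Relation.Nullary.Decidable using (map′; decidable-stable)
open import Relation.Unary using (Decidable; _⊆_)
open import Relation.Unary.Properties using (≐-refl; ≐-sym; ≐-trans)

private
  variable
    a c ℓ p : Level

-- Least elements and increasing enumerations of unbounded sets of naturals

lower-em : ExcludedMiddle (suc a) → ExcludedMiddle a
lower-em {a} em = map′ lower lift (em {Lift (suc a) _})

-- The witness `k` bounds the search: whenever `P 0` fails, the predicate is shifted by one and `k`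
-- drops by one.
least : {P : Pred ℕ p} → Decidable P → ∀ k → P k → ∃[ n ] P n × (∀ {m} → m < n → ¬ P m)
least P? k Pk with P? 0
least P? k         Pk | yes P0 = 0 , P0 , λ ()
least P? zero      P0 | no ¬P0 = contradiction P0 ¬P0
least P? (ℕ.suc k) Pk | no ¬P0 with n , Pn , below ← least (P? ∘ ℕ.suc) k Pk =
  ℕ.suc n , Pn , λ { {zero} _ → ¬P0 ; {ℕ.suc m} m<n → below (s<s⁻¹ m<n) }

module Enumerate {P : Pred ℕ p} (P? : Decidable P)
                 (unbounded : ∀ m → ∃[ k ] m ≤ k × P k) where

  private
    next : ∀ m → ∃[ k ] (m ≤ k × P k) × (∀ {j} → j < k → ¬ (m ≤ j × P j))
    next m with k , m≤k∧Pk ← unbounded m = least (λ k → (m ≤? k) ×-dec P? k) k m≤k∧Pk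

  enum : ℕ → ℕ
  enum zero      = proj₁ (next 0)
  enum (ℕ.suc n) = proj₁ (next (ℕ.suc (enum n)))

  enum-∈ : ∀ n → P (enum n)
  enum-∈ zero      = proj₂ (proj₁ (proj₂ (next 0)))
  enum-∈ (ℕ.suc n) = proj₂ (proj₁ (proj₂ (next (ℕ.suc (enum n)))))

  enum-<-suc : ∀ n → enum n < enum (ℕ.suc n)
  enum-<-suc n = proj₁ (proj₁ (proj₂ (next (ℕ.suc (enum n)))))

  enum-mono-< : ∀ {m n} → m < n → enum m < enum n
  enum-mono-< {m} {ℕ.suc n} m<1+n with m<1+n⇒m<n∨m≡n m<1+n
  ... | inj₁ m<n  = ℕ.<-trans (enum-mono-< m<n) (enum-<-suc n)
  ... | inj₂ refl = enum-<-suc n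

  n≤enum : ∀ n → n ≤ enum n
  n≤enum zero      = z≤n
  n≤enum (ℕ.suc n) = ≤-<-trans (n≤enum n) (enum-<-suc n)

  -- As `k < enum (k + 1)`, one descends from there. If `k` were never hit, it would lie below
  -- `enum 0` or strictly between two consecutive values, against the minimality in `next`.
  enum-surjective : ∀ {k} → P k → ∃[ n ] enum n ≡ k
  enum-surjective {k} Pk = below (ℕ.suc k) (n≤enum (ℕ.suc k))
    where
    below : ∀ n → k < enum n → ∃[ i ] enum i ≡ k
    below zero      k<  = contradiction (z≤n , Pk) (proj₂ (proj₂ (next 0)) k<)
    below (ℕ.suc n) k<  with <-cmp k (enum n)
    ... | tri< k<n _ _ = below n k<n
    ... | tri≈ _ k≡n _ = n , sym k≡n
    ... | tri> _ _ k>n = contradiction (k>n , Pk) (proj₂ (proj₂ (next _)) k<)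

-- A criterion for countable infinity

module _ (D : DecSetoid c ℓ) where
  open DecSetoid D renaming (Carrier to X; setoid to S; refl to ≈-refl; sym to ≈-sym; trans to ≈-trans)

  surjection∧injection⇒countablyInfinite :
    (e : ℕ → X) → StrictlySurjective _≈_ e →
    (h : ℕ → X) → Injective _≡_ _≈_ h → CountablyInfinite S
  surjection∧injection⇒countablyInfinite e e-surj h h-inj = record
    { to        = e ∘ enum
    ; cong      = λ { refl → ≈-refl }
    ; bijective = injective , strictlySurjective⇒surjective (setoid ℕ) S (λ { refl → ≈-refl }) surjective
    }
    where
    New : Pred ℕ _
    New k = ∀ {j} → j < k → ¬ (e j ≈ e k)

    first : ∀ x → ∃[ k ] e k ≈ x × New k
    first x with l , el≈x ← e-surj x
            with k , ek≈x , below ← least (λ k → e k ≟ x) l el≈x =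
      k , ek≈x , λ j<k ej≈ek → below j<k (≈-trans ej≈ek ek≈x)

    -- Were all of `h 0`, ..., `h m` listed before index `m`, two of these `m + 1` elements would
    -- share an index, against injectivity of `h`. So some `h i` is not listed that early, and its
    -- first index is at least `m`.
    unbounded : ∀ m → ∃[ k ] m ≤ k × New k
    unbounded m with all? (λ (i : Fin (ℕ.suc m)) → anyUpTo? (λ j → e j ≟ h (toℕ i)) m)
    ... | yes covered =
      let i , i′ , i<i′ , eq = pigeonhole ≤-refl λ i → fromℕ< (proj₁ (proj₂ (covered i)))
          j≡j′ = Fin.fromℕ<-injective _ _ _ _ eq
          hi≈hi′ = ≈-trans (≈-sym (proj₂ (proj₂ (covered i))))
                     (subst (λ j → e j ≈ h (toℕ i′)) (sym j≡j′) (proj₂ (proj₂ (covered i′))))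
      in contradiction (h-inj hi≈hi′) (ℕ.<⇒≢ i<i′)
    ... | no ¬covered =
      let i , fresh = ¬∀⟶∃¬ _ _ (λ i → anyUpTo? (λ j → e j ≟ h (toℕ i)) m) ¬covered
          k , ek≈hi , new = first (h (toℕ i))
      in k , ≮⇒≥ (λ k<m → fresh (k , k<m , ek≈hi)) , new

    open Enumerate {P = New} (λ k → allUpTo? (λ j → ¬? (e j ≟ e k)) k) unbounded

    injective : Injective _≡_ _≈_ (e ∘ enum)
    injective {m} {n} eq with <-cmp m n
    ... | tri< m<n _ _ = contradiction eq (enum-∈ n (enum-mono-< m<n))
    ... | tri≈ _ m≡n _ = m≡n
    ... | tri> _ _ n<m = contradiction (≈-sym eq) (enum-∈ m (enum-mono-< n<m))

    surjective : StrictlySurjective _≈_ (e ∘ enum)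
    surjective x with k , ek≈x , new ← first x with n , refl ← enum-surjective new = n , ek≈x

-- Countable and finite setoids

module _ (S : Setoid c ℓ) where
  open Setoid S using (_≈_) renaming (Carrier to X; sym to ≈-sym; trans to ≈-trans)

  -- In the finite case the given element of `X` is the default value at all indices from `n` on.
  countable⇒enumeration : Countable S → X → ∃[ e ] StrictlySurjective {A = ℕ} _≈_ e
  countable⇒enumeration (inj₂ b) _ = Bijection.to b , Bijection.strictlySurjective b
  countable⇒enumeration (inj₁ (n , b)) x₀ = e , e-surj
    where
    open Bijection b

    extend : ∀ {k} → Dec (k < n) → X
    extend (yes k<n) = to (fromℕ< k<n)
    extend (no _)    = x₀

    e : ℕ → X
    e k = extend (k <? n)

    -- The decision is arbitrary so that the proof can split on it; `toℕ i <? n` is put in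
    -- afterwards.
    extend-toℕ : ∀ i (d : Dec (toℕ i < n)) → extend d ≈ to i
    extend-toℕ i (yes i<n) = Bijection.cong b (fromℕ<-toℕ i i<n)
    extend-toℕ i (no i≮n)  = contradiction (toℕ<n i) i≮n

    e-surj : StrictlySurjective _≈_ e
    e-surj x with i , toi≈x ← strictlySurjective x =
      toℕ i , ≈-trans (extend-toℕ i (toℕ i <? n)) toi≈x

  lookup-injective : ∀ {xs} → Unique S xs → Injective _≡_ _≈_ (List.lookup xs)
  lookup-injective (_ ∷ _) {Fin.zero} {Fin.zero} _ = refl
  lookup-injective (x∉ ∷ _) {Fin.zero} {Fin.suc j} eq =
    contradiction (Membershipₚ.∈-resp-≈ S (≈-sym eq) (Membershipₚ.∈-lookup S _ j)) (Allₚ.All¬⇒¬Any x∉)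
  lookup-injective (x∉ ∷ _) {Fin.suc i} {Fin.zero} eq =
    contradiction (Membershipₚ.∈-resp-≈ S eq (Membershipₚ.∈-lookup S _ i)) (Allₚ.All¬⇒¬Any x∉)
  lookup-injective (_ ∷ u) {Fin.suc i} {Fin.suc j} eq = cong Fin.suc (lookup-injective u eq)

module _ (D : DecSetoid c ℓ) where
  open DecSetoid D using (_≈_; _≟_) renaming (setoid to S; sym to ≈-sym; trans to ≈-trans)
  open Membership S using () renaming (_∈_ to _∈ₗ_)

  -- Once duplicates are removed, distinct positions hold distinct elements, so the positions index
  -- the members bijectively.
  finite-∈-list : ∀ xs → Finite (members S (_∈ₗ xs))
  finite-∈-list xs = length ys , record
    { to        = λ i → List.lookup ys i , Membershipₚ.∈-deduplicate⁻ S _≟_ xs (Membershipₚ.∈-lookup S ys i)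
    ; cong      = λ { refl → Setoid.refl S }
    ; bijective = lookup-injective S (deduplicate-! D xs)
                , λ { (x , x∈xs) →
                      let x∈ys = Membershipₚ.∈-deduplicate⁺ S _≟_ (respʳ-flip S) x∈xs
                      in index x∈ys , λ { refl → ≈-sym (Anyₚ.lookup-index x∈ys) } }
    }
    where ys = deduplicate _≟_ xs

-- Coding lists of naturals by naturals

bump : List ℕ → List ℕ
bump []       = []
bump (n ∷ ns) = ℕ.suc n ∷ ns

-- A unary code in two digits: the entry `n` is written as `n` digits `1+[2_]` closed by one digit
-- `2[1+_]`. Digits `1+[2_]` that no `2[1+_]` closes are dropped by `bump []`, so every numeral
-- denotes a list.
decodeᵇ : ℕᵇ → List ℕ
decodeᵇ 0ᵇ       = []
decodeᵇ 2[1+ b ] = 0 ∷ decodeᵇ b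
decodeᵇ 1+[2 b ] = bump (decodeᵇ b)

decodeᵇ-surjective : StrictlySurjective _≡_ decodeᵇ
decodeᵇ-surjective []       = 0ᵇ , refl
decodeᵇ-surjective (n ∷ ns) = cons n
  where
  cons : ∀ n → ∃[ b ] decodeᵇ b ≡ n ∷ ns
  cons zero      = Product.map 2[1+_] (cong (0 ∷_)) (decodeᵇ-surjective ns)
  cons (ℕ.suc n) = Product.map 1+[2_] (cong bump) (cons n)

decode : ℕ → List ℕ
decode = decodeᵇ ∘ fromℕ

decode-surjective : StrictlySurjective _≡_ decode
decode-surjective ns with b , eq ← decodeᵇ-surjective ns =
  toℕᵇ b , trans (cong decodeᵇ (fromℕ-toℕ b)) eq

-- Padded with 0 beyond the end of the list.
nth : List ℕ → ℕ → ℕ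
nth []       _         = 0
nth (n ∷ _)  zero      = n
nth (_ ∷ ns) (ℕ.suc i) = nth ns i

nth-tabulate : ∀ {n} (f : Fin n → ℕ) i → nth (List.tabulate f) (toℕ i) ≡ f i
nth-tabulate f Fin.zero    = refl
nth-tabulate f (Fin.suc i) = nth-tabulate (f ∘ Fin.suc) i

-- Compatibility with equality of relations

R-mono : {A : Set a} {n : ℕ} {γ δ : Fin n → Pred A a} → (∀ i → γ i ⊆ δ i) → R γ ⊆ R δ
R-mono γ⊆δ (i , xᵢ∈γᵢ) = i , γ⊆δ i xᵢ∈γᵢ

R-cong : {A : Set a} {n : ℕ} {γ δ : Fin n → Pred A a} → (∀ i → γ i ≐ δ i) → R γ ≐ R δ
R-cong {γ = γ} {δ} γ≐δ =
    (λ {x} → R-mono {γ = γ} {δ} (λ i → proj₁ (γ≐δ i)) {x})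
  , (λ {x} → R-mono {γ = δ} {γ} (λ i → proj₂ (γ≐δ i)) {x})

▷-resp-≋ : {A : Set a} (f : Operation A) {ρ σ : Relation A} → ρ ≋ σ → f ▷ ρ → f ▷ σ
▷-resp-≋ f (same (ρ⊆σ , σ⊆ρ)) f▷ρ r r∈σ = ρ⊆σ (f▷ρ r (σ⊆ρ ∘ r∈σ))

-- `Pol` reverses inclusions, and inclusions up to `≋` suffice because preservation respects `≋`.
-- This form is needed since a finite `Q` is listed only up to `≋`.
Pol-cong : {A : Set a} {Q Q′ : Pred (Relation A) (suc a)} →
           (∀ {ρ} → ρ ∈ Q → ∃[ σ ] σ ∈ Q′ × σ ≋ ρ) →
           (∀ {ρ} → ρ ∈ Q′ → ∃[ σ ] σ ∈ Q × σ ≋ ρ) → Pol Q ≐ Pol Q′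
Pol-cong Q⊆Q′ Q′⊆Q = (λ {f} → anti Q′⊆Q f) , (λ {f} → anti Q⊆Q′ f)
  where
  anti : ∀ {Q Q′ : Pred (Relation _) _} → (∀ {ρ} → ρ ∈ Q → ∃[ σ ] σ ∈ Q′ × σ ≋ ρ) →
         ∀ f → f ∈ Pol Q′ → f ∈ Pol Q
  anti Q⊆Q′ f f∈ ρ ρ∈Q = let σ , σ∈Q′ , σ≋ρ = Q⊆Q′ ρ∈Q in ▷-resp-≋ f σ≋ρ (f∈ σ σ∈Q′)

DD-resp-≋ : {A : Set a} (Γ : Pred (Pred A a) (suc a)) {ρ σ : Relation A} →
            ρ ≋ σ → ρ ∈ DD Γ → σ ∈ DD Γ
DD-resp-≋ Γ (same ρ≐σ) (γ , γ∈Γ , ρ≐R) = γ , γ∈Γ , ≐-trans (≐-sym ρ≐σ) ρ≐R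

-- Upper bound: enumerating the clones

module Clones (em : ExcludedMiddle (suc a)) {A : Set a} (Γ : Pred (Pred A a) (suc a)) where

  open Setoid (finiteDDClones Γ) public using () renaming (Carrier to Clone; _≈_ to _≈ᶜ_)
  open Membership (relationSetoid A) public using () renaming (_∈_ to _∈ₗ_)
  open Setoid (relationSetoid A) public using () renaming (refl to ≋-refl; sym to ≋-sym; trans to ≋-trans)

  relationDecSetoid : DecSetoid (suc a) (suc a)
  relationDecSetoid = record
    { isDecEquivalence = record
      { isEquivalence = Setoid.isEquivalence (relationSetoid A) ; _≟_ = λ _ _ → em } }

  cloneDecSetoid : DecSetoid (suc (suc a)) (suc a)
  cloneDecSetoid = record
    { isDecEquivalence = record
      { isEquivalence = Setoid.isEquivalence (finiteDDClones Γ) ; _≟_ = λ _ _ → em } }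

  Polₗ : (ρs : List (Relation A)) → All (DD Γ) ρs → Clone
  Polₗ ρs ρs⊆DD = Pol (_∈ₗ ρs) , (_∈ₗ ρs)
    , All.lookupₛ (relationSetoid A) (DD-resp-≋ Γ) ρs⊆DD
    , finite-∈-list relationDecSetoid ρs
    , ≐-refl

  module Enumeration (g : ℕ → Pred A a) (g∈Γ : ∀ n → g n ∈ Γ)
                     (g-surj : ∀ {γ} → γ ∈ Γ → ∃[ n ] g n ≐ γ) where

    -- The head is the arity minus one, and the entries after it are indices of members of `Γ`. The
    -- padding in `nth` makes every list denote a relation in `DD Γ`.
    disjunction : List ℕ → Relation A
    disjunction ns = nth ns 0 , R (λ i → g (nth ns (ℕ.suc (toℕ i))))

    disjunction-∈DD : ∀ ns → disjunction ns ∈ DD Γ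
    disjunction-∈DD ns = _ , (λ _ → g∈Γ _) , ≐-refl

    disjunction-surj : ∀ {ρ} → ρ ∈ DD Γ → ∃[ ns ] disjunction ns ≋ ρ
    disjunction-surj {k , ρ} (γ , γ∈Γ , ρ≐R) = k ∷ List.tabulate code , same (≐-trans (R-cong eq) (≐-sym ρ≐R))
      where
      code : Fin (ℕ.suc k) → ℕ
      code i = proj₁ (g-surj (γ∈Γ i))
      eq : ∀ i → g (nth (List.tabulate code) (toℕ i)) ≐ γ i
      eq i = subst (λ n → g n ≐ γ i) (sym (nth-tabulate code i)) (proj₂ (g-surj (γ∈Γ i)))

    relations : List ℕ → List (Relation A)
    relations = List.map (disjunction ∘ decode)

    clone : List ℕ → Clone
    clone ns = Polₗ (relations ns) (Allₚ.map⁺ (All.universal (disjunction-∈DD ∘ decode) ns))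

    -- The bijection with `Fin n` meets every member of `Q` up to `≋`; the list consists of one code
    -- for each of its values.
    clone-surjective : StrictlySurjective _≈ᶜ_ clone
    clone-surjective (C , Q , Q⊆DD , (n , b) , C≐Pol) =
      List.tabulate code , ≐-trans {j = Pol Q} (Pol-cong list⊆Q Q⊆list) (≐-sym C≐Pol)
      where
      open Bijection b using (to; strictlySurjective)

      coded : ∀ i → ∃[ m ] disjunction (decode m) ≋ proj₁ (to i)
      coded i =
        let ns , ns≋ = disjunction-surj (Q⊆DD (proj₂ (to i)))
            m , decode-m≡ns = decode-surjective ns
        in m , subst (λ ns → disjunction ns ≋ proj₁ (to i)) (sym decode-m≡ns) ns≋

      code : Fin n → ℕ
      code = proj₁ ∘ coded

      Q⊆list : ∀ {ρ} → ρ ∈ Q → ∃[ σ ] σ ∈ₗ relations (List.tabulate code) × σ ≋ ρ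
      Q⊆list {ρ} ρ∈Q =
        let i , toi≋ρ = strictlySurjective (ρ , ρ∈Q)
        in disjunction (decode (code i))
           , Anyₚ.map⁺ (Anyₚ.tabulate⁺ i ≋-refl)
           , ≋-trans (proj₂ (coded i)) toi≋ρ

      list⊆Q : ∀ {ρ} → ρ ∈ₗ relations (List.tabulate code) → ∃[ σ ] σ ∈ Q × σ ≋ ρ
      list⊆Q ρ∈ =
        let i , ρ≋ = Anyₚ.tabulate⁻ (Anyₚ.map⁻ ρ∈)
        in proj₁ (to i) , proj₂ (to i) , ≋-sym (≋-trans ρ≋ (proj₂ (coded i)))

    -- Two levels of coding: this `decode` yields a list of codes, and the one inside `relations`
    -- turns each code into a description of a relation.
    clone∘decode-surjective : StrictlySurjective _≈ᶜ_ (clone ∘ decode)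
    clone∘decode-surjective C =
      let ns , ns≈ = clone-surjective C
          m , decode-m≡ns = decode-surjective ns
      in m , subst (λ ns → clone ns ≈ᶜ C) (sym decode-m≡ns) ns≈

-- Lower bound: threshold operations

module Threshold (em : ExcludedMiddle a) {A : Set a} {γ : Pred A a} {x y : A} (x∈γ : x ∈ γ) (y∉γ : ¬ y ∈ γ) where

  indicator : {P : Set p} → Dec P → A
  indicator (yes _) = x
  indicator (no _)  = y

  indicator⁺ : {P : Set p} (d : Dec P) → P → indicator d ∈ γ
  indicator⁺ (yes _) _ = x∈γ
  indicator⁺ (no ¬P) P = contradiction P ¬P

  indicator⁻ : {P : Set p} (d : Dec P) → indicator d ∈ γ → P
  indicator⁻ (yes P) _ = P
  indicator⁻ (no _)  y∈γ = contradiction y∈γ y∉γ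

  Twice : ∀ {n} → Vec A n → Set a
  Twice v = ∃[ i ] ∃[ j ] i ≢ j × lookup v i ∈ γ × lookup v j ∈ γ

  -- By the convention on arities this has arity `m + 2`, one more than the arity `m + 1` of
  -- `power m`.
  threshold : ℕ → Operation A
  threshold m = ℕ.suc m , λ v → indicator (em {Twice v})

  power : ℕ → Relation A
  power n = n , R {n = ℕ.suc n} (const γ)

  lookup-tabulate⁺ : ∀ {n} (f : Fin n → A) i → f i ∈ γ → lookup (tabulate f) i ∈ γ
  lookup-tabulate⁺ f i = subst γ (sym (lookup∘tabulate f i))

  lookup-tabulate⁻ : ∀ {n} (f : Fin n → A) i → lookup (tabulate f) i ∈ γ → f i ∈ γ
  lookup-tabulate⁻ f i = subst γ (lookup∘tabulate f i)

  threshold-▷ : ∀ m → threshold m ▷ power m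
  -- Each of the `m + 2` tuples has an entry in `γ` at one of `m + 1` coordinates. Two tuples share
  -- such a coordinate `j`, so column `j` has two entries in `γ`.
  threshold-▷ m r r∈ with i , i′ , i<i′ , j≡j′ ← pigeonhole ≤-refl (proj₁ ∘ r∈) =
    j , lookup-tabulate⁺ (proj₂ (threshold m) ∘ tabulate ∘ column) j (indicator⁺ em twice)
    where
    j = proj₁ (r∈ i)

    column : Fin (ℕ.suc m) → Fin (ℕ.suc (ℕ.suc m)) → A
    column j i = lookup (r i) j

    twice : Twice (tabulate (column j))
    twice = i , i′ , (ℕ.<⇒≢ i<i′ ∘ cong toℕ)
      , lookup-tabulate⁺ (column j) i (proj₂ (r∈ i))
      , lookup-tabulate⁺ (column j) i′
          (subst (λ j → column j i′ ∈ γ) (sym j≡j′) (proj₂ (r∈ i′)))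

  threshold-¬▷ : ∀ {m n} → m < n → ¬ threshold m ▷ power n
  threshold-¬▷ {m} {n} m<n f▷ =
    -- A result in `γ` at `j` means two distinct rows with entry in `γ` there; both then have their
    -- unit position at `j`, although `ι` is injective.
    let j , fj∈ = f▷ (tabulate ∘ unit) unit-∈
        i , i′ , i≢i′ , i∈ , i′∈ =
          indicator⁻ em (lookup-tabulate⁻ (proj₂ (threshold m) ∘ tabulate ∘ column) j fj∈)
    in i≢i′ (inject≤-injective _ _ i i′ (trans (hit i j i∈) (sym (hit i′ j i′∈))))
    where
    -- Since `m < n`, there is room for `m + 2` distinct unit positions among `n + 1` coordinates.
    ι : Fin (ℕ.suc (ℕ.suc m)) → Fin (ℕ.suc n)
    ι i = inject≤ i (s≤s m<n)

    unit : Fin (ℕ.suc (ℕ.suc m)) → Fin (ℕ.suc n) → A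
    unit i j = indicator (ι i Fin.≟ j)

    unit-∈ : ∀ i → tabulate (unit i) ∈ proj₂ (power n)
    unit-∈ i = ι i , lookup-tabulate⁺ (unit i) (ι i) (indicator⁺ (ι i Fin.≟ ι i) refl)

    column : Fin (ℕ.suc n) → Fin (ℕ.suc (ℕ.suc m)) → A
    column j i = lookup (tabulate (unit i)) j

    hit : ∀ i j → lookup (tabulate (column j)) i ∈ γ → ι i ≡ j
    hit i j = indicator⁻ (ι i Fin.≟ j) ∘ lookup-tabulate⁻ (unit i) j ∘ lookup-tabulate⁻ (column j) i

-- Combining the enumeration with an infinite family of clones

corollary25 : {a : Level} → ExcludedMiddle (suc a) →
    (A : Set a) (Γ : Pred (Pred A a) (suc a)) →
    Countable (members (≐-setoid A a) Γ) →
    (∃[ γ ] γ ∈ Γ × ¬ (γ ≐ ∅) × γ ⊂ U) →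
    CountablyInfinite (finiteDDClones Γ)
corollary25 {a} em A Γ Γ-countable (γ , γ∈Γ , γ≉∅ , _ , U⊈γ) =
  surjection∧injection⇒countablyInfinite cloneDecSetoid
    (clone ∘ decode) clone∘decode-surjective powerClone powerClone-injective
  where
  open Clones em Γ

  -- The given `γ` serves as the default value if `Γ` is finite.
  enumeration = countable⇒enumeration (members (≐-setoid A a) Γ) Γ-countable (γ , γ∈Γ)
  open Enumeration (proj₁ ∘ proj₁ enumeration) (proj₂ ∘ proj₁ enumeration)
                   (λ {δ} δ∈Γ → proj₂ enumeration (δ , δ∈Γ))

  em₀ : ExcludedMiddle a
  em₀ = lower-em em

  -- Excluded middle turns the negated hypotheses on `γ` into actual elements inside and outside it.
  inside : ∃ γ
  inside = decidable-stable em₀ λ ∄x → γ≉∅ ((λ {x} x∈γ → ∄x (x , x∈γ)) , λ ())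

  outside : ∃[ y ] ¬ y ∈ γ
  outside = decidable-stable em₀ λ ∄y → U⊈γ λ {y} _ → decidable-stable em₀ λ y∉γ → ∄y (y , y∉γ)

  open Threshold em₀ {γ = γ} (proj₂ inside) (proj₂ outside)

  powerClone : ℕ → Clone
  powerClone n = Polₗ (power n ∷ []) ((const γ , (λ _ → γ∈Γ) , ≐-refl) ∷ [])

  threshold-∈ : ∀ m → threshold m ∈ proj₁ (powerClone m)
  threshold-∈ m _ (here ρ≋) = ▷-resp-≋ (threshold m) (≋-sym ρ≋) (threshold-▷ m)

  threshold-∉ : ∀ {m n} → m < n → ¬ threshold m ∈ proj₁ (powerClone n)
  threshold-∉ m<n f∈ = threshold-¬▷ m<n (f∈ _ (here ≋-refl))

  -- Of two different indices, the threshold operation of the smaller one lies in its own clone but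
  -- not in the other.
  powerClone-injective : Injective _≡_ _≈ᶜ_ powerClone
  powerClone-injective {m} {n} (m⊆n , n⊆m) with <-cmp m n
  ... | tri< m<n _ _ = contradiction (m⊆n {threshold m} (threshold-∈ m)) (threshold-∉ m<n)
  ... | tri≈ _ m≡n _ = m≡n
  ... | tri> _ _ n<m = contradiction (n⊆m {threshold n} (threshold-∈ n)) (threshold-∉ n<m)
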